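{- Let $\langle L,\leq,{}^\bot,\wedge\rangle$ be an orthomodular lattice (with join $\vee$), and define the binary operation $\&_\wedge : L^2\to L$ by $$ a \,\&_\wedge\, b = b \wedge (b^\bot \vee a). $$ Then $\langle L,\leq,{}^\bot,\&_\wedge\rangle$ is a Sasaki orthoposet.
   Context: A bounded orthoposet $\langle P,\leq,{}^\bot\rangle$ is a partially ordered set with least element $0$ and greatest element $1$ and an orthocomplementation $a\mapsto a^\bot$, i.e. an order-reversing involution ($a\le b\Rightarrow b^\bot\le a^\bot$, $a^{\bot\bot}=a$) such that for every $a$ the meet of $a$ and $a^\bot$ exists and is $0$, and their join exists and is $1$. An ortholattice is a bounded orthoposet that is a lattice. An orthomodular lattice is an ortholattice in which $a\leq b$ implies $a=b\wedge(a\vee b^\bot)$. A Sasaki orthoposet is a tuple $\langle P,\leq,{}^\bot,\&\rangle$ where $\langle P,\leq,{}^\bot\rangle$ is a bounded orthoposet and $\&:P^2\to P$ is a total binary operation such that for all $a,b,c\in P$: (L-Monotony) $a\le b \Rightarrow a\,\&\,c\le b\,\&\,c$; (R-Reduction) $a\,\&\,b\le b$; (Orthomodularity) $a\le b\Rightarrow a=a\,\&\,b$; (Galois) $a\,\&\,b\le c\Rightarrow c^\bot\,\&\,b\le a^\bot$. -}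

module Defs where

open import Algebra.Core using (Op₁; Op₂)
open import Algebra.Definitions using (Congruent₂; Involutive)
open import Data.Product.Base using (_×_)
open import Function.Base using (flip)
open import Level using (Level; suc; _⊔_)
open import Relation.Binary.Core using (Rel)
open import Relation.Binary.Definitions using (Maximum; Minimum)
open import Relation.Binary.Structures using (IsPartialOrder)
open import Relation.Binary.Lattice.Definitions using (Supremum; Infimum)
open import Relation.Binary.Lattice.Structures using (IsLattice)

-- The library's Supremum and Infimum speak about total operations; in a poset
-- only particular joins and meets need exist, hence these pointwise versions.

IsJoin : ∀ {a ℓ : Level} {A : Set a} → Rel A ℓ → A → A → A → Set (a ⊔ ℓ)
IsJoin _≤_ x y s = x ≤ s × y ≤ s × (∀ z → x ≤ z → y ≤ z → s ≤ z)

IsMeet : ∀ {a ℓ : Level} {A : Set a} → Rel A ℓ → A → A → A → Set (a ⊔ ℓ)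
IsMeet _≤_ = IsJoin (flip _≤_)

module _ {a ℓ₁ ℓ₂ : Level} {A : Set a} (_≈_ : Rel A ℓ₁) (_≤_ : Rel A ℓ₂) where

  record IsBoundedOrthoposet (_^⊥ : Op₁ A) (0# 1# : A) : Set (a ⊔ ℓ₁ ⊔ ℓ₂) where
    field
      isPartialOrder : IsPartialOrder _≈_ _≤_
      minimum        : Minimum _≤_ 0#
      maximum        : Maximum _≤_ 1#
      ^⊥-antitone    : ∀ {x y} → x ≤ y → (y ^⊥) ≤ (x ^⊥)
      ^⊥-involutive  : Involutive _≈_ _^⊥
      ^⊥-meet        : ∀ x → IsMeet _≤_ x (x ^⊥) 0#
      ^⊥-join        : ∀ x → IsJoin _≤_ x (x ^⊥) 1#

    open IsPartialOrder isPartialOrder public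

  record IsOrtholattice (_∨_ _∧_ : Op₂ A) (_^⊥ : Op₁ A) (0# 1# : A)
                        : Set (a ⊔ ℓ₁ ⊔ ℓ₂) where
    field
      isBoundedOrthoposet : IsBoundedOrthoposet _^⊥ 0# 1#
      supremum            : Supremum _≤_ _∨_
      infimum             : Infimum _≤_ _∧_

    open IsBoundedOrthoposet isBoundedOrthoposet public

    isLattice : IsLattice _≈_ _≤_ _∨_ _∧_
    isLattice = record
      { isPartialOrder = isPartialOrder
      ; supremum       = supremum
      ; infimum        = infimum
      }

    open IsLattice isLattice public
      using (x≤x∨y; y≤x∨y; ∨-least; x∧y≤x; x∧y≤y; ∧-greatest)

  record IsOrthomodularLattice (_∨_ _∧_ : Op₂ A) (_^⊥ : Op₁ A) (0# 1# : A)
                               : Set (a ⊔ ℓ₁ ⊔ ℓ₂) where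
    field
      isOrtholattice : IsOrtholattice _∨_ _∧_ _^⊥ 0# 1#
      orthomodular   : ∀ {x y} → x ≤ y → x ≈ (y ∧ (x ∨ (y ^⊥)))

    open IsOrtholattice isOrtholattice public

  record IsSasakiOrthoposet (_^⊥ : Op₁ A) (_&_ : Op₂ A) (0# 1# : A)
                            : Set (a ⊔ ℓ₁ ⊔ ℓ₂) where
    field
      isBoundedOrthoposet : IsBoundedOrthoposet _^⊥ 0# 1#
      -- _&_ has to be a function on the setoid (A , _≈_); this is automatic
      -- when _≈_ is propositional equality.
      &-cong              : Congruent₂ _≈_ _&_
      &-monoˡ             : ∀ {x y} z → x ≤ y → (x & z) ≤ (y & z)
      &-reductionʳ        : ∀ x y → (x & y) ≤ y
      &-orthomodular      : ∀ {x y} → x ≤ y → x ≈ (x & y)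
      &-galois            : ∀ {x y z} → (x & y) ≤ z → ((z ^⊥) & y) ≤ (x ^⊥)

    open IsBoundedOrthoposet isBoundedOrthoposet public

record OrthomodularLattice (c ℓ₁ ℓ₂ : Level) : Set (suc (c ⊔ ℓ₁ ⊔ ℓ₂)) where
  infix  4 _≈_ _≤_
  infixr 6 _∨_
  infixr 7 _∧_ _&∧_
  infix  8 _^⊥
  field
    Carrier               : Set c
    _≈_                   : Rel Carrier ℓ₁
    _≤_                   : Rel Carrier ℓ₂
    _∨_                   : Op₂ Carrier
    _∧_                   : Op₂ Carrier
    _^⊥                   : Op₁ Carrier
    0#                    : Carrier
    1#                    : Carrier
    isOrthomodularLattice : IsOrthomodularLattice _≈_ _≤_ _∨_ _∧_ _^⊥ 0# 1#

  open IsOrthomodularLattice isOrthomodularLattice public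

  -- The Sasaki projection of x onto y.
  _&∧_ : Op₂ Carrier
  x &∧ y = y ∧ (y ^⊥ ∨ x)

{-# OPTIONS --safe #-}
-- The Galois law reduces, since _&∧_ is monotone on the left, to
-- (x & y)^⊥ & y ≤ x^⊥.  By de Morgan (x & y)^⊥ ≤ y^⊥ ∨ (y ∧ x^⊥), and
-- orthomodularity for y ∧ x^⊥ ≤ y says that (y ∧ x^⊥) & y ≈ y ∧ x^⊥ ≤ x^⊥.
module Submission where

open import Defs
open import Level using (Level)
open import Relation.Binary.Lattice.Bundles using (Lattice)
import Relation.Binary.Lattice.Properties.JoinSemilattice as JoinProperties
import Relation.Binary.Lattice.Properties.MeetSemilattice as MeetProperties

module SasakiProjection {c ℓ₁ ℓ₂ : Level} (L : OrthomodularLattice c ℓ₁ ℓ₂) where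
  open OrthomodularLattice L

  lattice : Lattice c ℓ₁ ℓ₂
  lattice = record { isLattice = isLattice }

  open Lattice lattice using (joinSemilattice; meetSemilattice)
  open JoinProperties joinSemilattice using (∨-monotonic; ∨-comm)
  open MeetProperties meetSemilattice using (∧-monotonic; ∧-cong)

  -- Antitony gives `y ^⊥ ≤ (x ^⊥) ^⊥`, and involutivity removes the double complement.
  ^⊥-swapˡ : ∀ {x y} → x ^⊥ ≤ y → y ^⊥ ≤ x
  ^⊥-swapˡ {x} x⊥≤y = trans (^⊥-antitone x⊥≤y) (reflexive (^⊥-involutive x))

  -- After a swap it suffices that `(x ^⊥ ∨ y ^⊥) ^⊥` is a lower bound of `x` and `y`; each bound is
  -- again a swap.
  ∧-deMorgan-≤ : ∀ x y → (x ∧ y) ^⊥ ≤ x ^⊥ ∨ y ^⊥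
  ∧-deMorgan-≤ x y = ^⊥-swapˡ
    (∧-greatest (^⊥-swapˡ (x≤x∨y _ _)) (^⊥-swapˡ (y≤x∨y _ _)))

  -- Only `x` is complemented, to match the factor `y ^⊥ ∨ x` of `x &∧ y` with no double complement
  -- left over.
  ∨-deMorgan-≤ : ∀ x y → (x ^⊥ ∨ y) ^⊥ ≤ x ∧ y ^⊥
  ∨-deMorgan-≤ x y =
    ∧-greatest (^⊥-swapˡ (x≤x∨y _ _)) (^⊥-antitone (y≤x∨y _ _))

  -- Serves both congruence and left monotony. The second argument varies only up to `≈`: it occurs
  -- both plainly and complemented, so `_&∧_` need not be monotone in it.
  &-mono-≈ : ∀ {x x′ y y′} → x ≤ x′ → y ≈ y′ → x &∧ y ≤ x′ &∧ y′
  &-mono-≈ x≤x′ y≈y′ =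
    ∧-monotonic (reflexive y≈y′)
      (∨-monotonic (^⊥-antitone (reflexive (Eq.sym y≈y′))) x≤x′)

  &-cong : ∀ {x x′ y y′} → x ≈ x′ → y ≈ y′ → x &∧ y ≈ x′ &∧ y′
  &-cong x≈x′ y≈y′ = antisym
    (&-mono-≈ (reflexive x≈x′) y≈y′)
    (&-mono-≈ (reflexive (Eq.sym x≈x′)) (Eq.sym y≈y′))

  &-monoˡ : ∀ {x y} z → x ≤ y → x &∧ z ≤ y &∧ z
  &-monoˡ z x≤y = &-mono-≈ x≤y Eq.refl

  &-orthomodular : ∀ {x y} → x ≤ y → x ≈ x &∧ y
  &-orthomodular {x} {y} x≤y =
    Eq.trans (orthomodular x≤y) (∧-cong Eq.refl (∨-comm x (y ^⊥)))

  &-^⊥-≤ : ∀ x y → (x &∧ y) ^⊥ ≤ y ^⊥ ∨ (y ∧ x ^⊥)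
  &-^⊥-≤ x y =
    trans (∧-deMorgan-≤ y (y ^⊥ ∨ x)) (∨-monotonic refl (∨-deMorgan-≤ y x))

  &-^⊥-& : ∀ x y → (x &∧ y) ^⊥ &∧ y ≤ x ^⊥
  &-^⊥-& x y =
    -- The bound on `(x &∧ y) ^⊥` already contains `y ^⊥`, so joining with `y ^⊥` adds nothing and
    -- `(y ∧ x ^⊥) &∧ y` is an upper bound.
    trans (∧-monotonic refl (∨-least (x≤x∨y _ _) (&-^⊥-≤ x y)))
      (trans (reflexive (Eq.sym (&-orthomodular (x∧y≤x y (x ^⊥)))))
        (x∧y≤y y (x ^⊥)))

  &-galois : ∀ {x y z} → x &∧ y ≤ z → z ^⊥ &∧ y ≤ x ^⊥
  &-galois {x} {y} x&y≤z = trans (&-monoˡ y (^⊥-antitone x&y≤z)) (&-^⊥-& x y)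

proposition4 : ∀ {c ℓ₁ ℓ₂ : Level} (L : OrthomodularLattice c ℓ₁ ℓ₂) →
    let open OrthomodularLattice L in
    IsSasakiOrthoposet _≈_ _≤_ _^⊥ _&∧_ 0# 1#
proposition4 L = record
  { isBoundedOrthoposet = isBoundedOrthoposet
  ; &-cong              = &-cong
  ; &-monoˡ             = &-monoˡ
  ; &-reductionʳ        = λ x y → x∧y≤x y (y ^⊥ ∨ x)
  ; &-orthomodular      = &-orthomodular
  ; &-galois            = &-galois
  }
  where
  open OrthomodularLattice L
  open SasakiProjection L
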